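{- For every prime $p$ there exists a minion homomorphism $\mathcal V_p\text{ - }\mathbb Z_p\to\mathcal Z_{p^2}$.
   Context: A minion $\mathcal R$ is a functor from finite sets to sets: it assigns a set $\mathcal R^{(D)}$ to each finite set $D$ and a map $\mathcal R^{(\alpha)}:\mathcal R^{(D)}\to\mathcal R^{(E)}$ to each function $\alpha:D\to E$ between finite sets, preserving identities and composition. A minion homomorphism $\xi:\mathcal R\to\mathcal S$ is a natural transformation: a family of functions $\xi^{(D)}:\mathcal R^{(D)}\to\mathcal S^{(D)}$ with $\xi^{(E)}\circ\mathcal R^{(\alpha)}=\mathcal S^{(\alpha)}\circ\xi^{(D)}$ for every $\alpha:D\to E$. For $m\in\mathbb N$, the minion $\mathcal Z_m$ is given by $\mathcal Z_m^{(D)}=\{f:D\to\mathbb Z_m\mid\sum_{a\in D}f(a)=1\}$ (where $\mathbb Z_m$ is the ring of integers modulo $m$), and for $\alpha:D\to E$, $\mathcal Z_m^{(\alpha)}(f)(b)=\sum_{a\in\alpha^{ -1}(b)}f(a)$. For a prime $p$ and $k\ge2$, the minion $\mathcal V_k\text{ - }\mathbb Z_p$ is defined as follows; all computations are in the field $\mathbb Z_p$. For vectors in $\mathbb Z_p^N$ let $\mathfrak w(v_1,\dots,v_N)=v_1+\cdots+v_N$ and let $\odot$ denote the componentwise product. For a finite set $D$, $(\mathcal V_k\text{ - }\mathbb Z_p)^{(D)}$ is the set of triples $(V,\mathbf i,\mathbf v)$ where $V$ is a linear subspace of $\mathbb Z_p^N$ for some $N\in\mathbb N$, $\mathbf i\in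 V$, and $\mathbf v:D\to V$, such that: (i) $\mathbf i=(1,1,\dots,1)$ and $\mathfrak w(\mathbf i)=1$; (s) $\sum_{a\in D}\mathbf v(a)=\mathbf i$; (o) $\mathfrak w(\mathbf v(a)\odot\mathbf v(b)\odot\mathbf u_1\odot\cdots\odot\mathbf u_{k-2})=0$ for all $a\ne b$ in $D$ and all $\mathbf u_1,\dots,\mathbf u_{k-2}\in V$; (p) $\mathfrak w(\mathbf v(a)\odot\mathbf v(a)\odot\mathbf u_1\odot\cdots\odot\mathbf u_{k-2})=\mathfrak w(\mathbf v(a)\odot\mathbf u_1\odot\cdots\odot\mathbf u_{k-2})$ for all $a\in D$ and all $\mathbf u_1,\dots,\mathbf u_{k-2}\in V$. For $\alpha:D\to E$, $(\mathcal V_k\text{ - }\mathbb Z_p)^{(\alpha)}(V,\mathbf i,\mathbf v)=(V,\mathbf i,\mathbf v')$ with $\mathbf v'(b)=\sum_{a\in\alpha^{ -1}(b)}\mathbf v(a)$. The claim concerns the case $k=p$. -}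

module Defs where

open import Algebra.Bundles using (CommutativeMonoid; CommutativeRing)
import Algebra.Properties.CommutativeMonoid.Sum as Sum
import Algebra.Properties.Semiring.Sum as SemiringSum
open import Data.Bool.Base using (if_then_else_)
open import Data.Fin.Base using (Fin; zero; suc)
import Data.Fin.Properties as Fin
open import Data.Integer.Base as ℤ using (ℤ; +_; 0ℤ; 1ℤ)
import Data.Integer.Properties as ℤ
open import Data.Integer.Divisibility.Signed
  using (_∣_; divides; ∣m⇒∣-m; ∣m∣n⇒∣m+n; ∣m⇒∣m*n; ∣n⇒∣m*n)
import Data.Integer.Tactic.RingSolver as ℤSolver
open import Data.Nat.Base as ℕ using (ℕ; NonTrivial)
open import Data.Nat.Primality using (Prime)
open import Data.Product.Base using (Σ; _,_; _×_; proj₁; proj₂)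
open import Data.Vec.Functional using (Vector; foldr; zipWith; replicate)
open import Function.Base using (_∘_; id)
open import Function.Bundles using (Func; Inverse; _↔_)
open import Level using (Level; 0ℓ; _⊔_) renaming (suc to lsuc)
open import Relation.Binary.Bundles using (Setoid)
open import Relation.Binary.Definitions using (DecidableEquality)
open import Relation.Binary.PropositionalEquality as ≡ using (_≡_; _≢_; _≗_)
open import Relation.Nullary using (¬_; Dec; yes; no; does; contradiction)
open import Relation.Nullary.Decidable using (via-injection)
open import Function.Properties.Inverse using (↔⇒↣)
open import Relation.Unary using (Pred; _∈_; _≐_)
import Relation.Unary.Properties as Unary

private variable
  a b c ℓ ℓ₁ ℓ₂ : Level

------------------------------------------------------------------------
-- Finite sets

record FinSet : Set₁ where
  field
    ∣_∣    : Set
    size   : ℕ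
    finite : ∣_∣ ↔ Fin size

  _≟_ : DecidableEquality ∣_∣
  _≟_ = via-injection (↔⇒↣ finite) Fin._≟_

open FinSet using (∣_∣)

------------------------------------------------------------------------
-- Minions

-- Sets are modelled by setoids, so that elements of a minion can be
-- functions and subsets, compared extensionally.  The field map-cong
-- expresses that pointwise equal functions between finite sets are equal.

record Minion (a ℓ : Level) : Set (lsuc (lsuc 0ℓ ⊔ a ⊔ ℓ)) where
  field
    obj : FinSet → Setoid a ℓ
    map : ∀ {D E} → (∣ D ∣ → ∣ E ∣) → Func (obj D) (obj E)

  infix 4 _≈_
  _≈_ : ∀ {D} → Setoid.Carrier (obj D) → Setoid.Carrier (obj D) → Set ℓ
  _≈_ {D} = Setoid._≈_ (obj D)

  infixr 5 _⟪$⟫_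
  _⟪$⟫_ : ∀ {D E} → (∣ D ∣ → ∣ E ∣) →
          Setoid.Carrier (obj D) → Setoid.Carrier (obj E)
  _⟪$⟫_ {D} {E} α = Func.to (map {D} {E} α)

  field
    map-cong : ∀ {D E} {α β : ∣ D ∣ → ∣ E ∣} → α ≗ β →
               ∀ x → _≈_ {E} (_⟪$⟫_ {D} {E} α x) (_⟪$⟫_ {D} {E} β x)
    map-id   : ∀ {D} x → _≈_ {D} (_⟪$⟫_ {D} {D} id x) x
    map-∘    : ∀ {D E F} (β : ∣ E ∣ → ∣ F ∣) (α : ∣ D ∣ → ∣ E ∣) x →
               _≈_ {F} (_⟪$⟫_ {D} {F} (β ∘ α) x)
                       (_⟪$⟫_ {E} {F} β (_⟪$⟫_ {D} {E} α x))

record MinionHom (ℛ : Minion a ℓ₁) (𝒮 : Minion b ℓ₂) :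
                 Set (lsuc 0ℓ ⊔ a ⊔ b ⊔ ℓ₁ ⊔ ℓ₂) where
  private
    module ℛ = Minion ℛ
    module 𝒮 = Minion 𝒮
  field
    ξ       : ∀ D → Func (ℛ.obj D) (𝒮.obj D)
    natural : ∀ {D E} (α : ∣ D ∣ → ∣ E ∣) x →
              𝒮._≈_ {E} (Func.to (ξ E) (ℛ._⟪$⟫_ {D} {E} α x))
                        (𝒮._⟪$⟫_ {D} {E} α (Func.to (ξ D) x))

------------------------------------------------------------------------
-- Sums indexed by finite sets and by fibres α⁻¹(b)

module FinSum (M : CommutativeMonoid c ℓ) where
  open CommutativeMonoid M
  open Sum M
  open import Relation.Binary.Reasoning.Setoid setoid

  private variable
    P   : Set
    x y : Carrier

  when : Dec P → Carrier → Carrier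
  when d x = if does d then x else ε

  ∑ : ∀ D → (∣ D ∣ → Carrier) → Carrier
  ∑ D f = sum (f ∘ Inverse.from (FinSet.finite D))

  ∑⁻¹ : ∀ D E → (∣ D ∣ → ∣ E ∣) → ∣ E ∣ → (∣ D ∣ → Carrier) → Carrier
  ∑⁻¹ D E α b f = ∑ D λ a → when (FinSet._≟_ E (α a) b) (f a)

  when-cong : (d : Dec P) → (P → x ≈ y) → when d x ≈ when d y
  when-cong (yes p) x≈y = x≈y p
  when-cong (no _)  _   = refl

  when-yes : (d : Dec P) → P → when d x ≈ x
  when-yes (yes _) _ = refl
  when-yes (no ¬p) p = contradiction p ¬p

  when-no : (d : Dec P) → ¬ P → when d x ≈ ε
  when-no (yes p) ¬p = contradiction p ¬p
  when-no (no _)  _  = refl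

  when-ε : (d : Dec P) → when d ε ≈ ε
  when-ε (yes _) = refl
  when-ε (no _)  = refl

  ∑-cong : ∀ D {f g : ∣ D ∣ → Carrier} → (∀ a → f a ≈ g a) → ∑ D f ≈ ∑ D g
  ∑-cong D f≈g = sum-cong-≋ {FinSet.size D} λ i → f≈g (Inverse.from (FinSet.finite D) i)

  ∑-zero : ∀ D {f : ∣ D ∣ → Carrier} → (∀ a → f a ≈ ε) → ∑ D f ≈ ε
  ∑-zero D f≈0 = trans (∑-cong D f≈0) (sum-replicate-zero (FinSet.size D))

  sum-single : ∀ {n} (f : Vector Carrier n) i →
               (∀ j → j ≢ i → f j ≈ ε) → sum f ≈ f i
  sum-single {ℕ.suc n} f zero f≈0 =
    trans (∙-congˡ (trans (sum-cong-≋ {n} λ j → f≈0 (suc j) λ ())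
                          (sum-replicate-zero n)))
          (identityʳ _)
  sum-single f (suc i) f≈0 =
    trans (∙-cong (f≈0 zero λ ())
                  (sum-single (f ∘ suc) i
                    λ j j≢i → f≈0 (suc j) (j≢i ∘ Fin.suc-injective)))
          (identityˡ _)

  ∑-single : ∀ D (f : ∣ D ∣ → Carrier) a → (∀ b → b ≢ a → f b ≈ ε) → ∑ D f ≈ f a
  ∑-single D f a f≈0 = begin
    ∑ D f         ≈⟨ sum-single _ (to a) (λ j j≢a → f≈0 (from j) (j≢a ∘ lemma j)) ⟩
    f (from (to a)) ≡⟨ ≡.cong f (strictlyInverseʳ a) ⟩
    f a           ∎
    where
    open Inverse (FinSet.finite D)
    lemma : ∀ j → from j ≡ a → j ≡ to a
    lemma j ≡.refl = ≡.sym (strictlyInverseˡ j)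

  module _ (D E : FinSet) (α : ∣ D ∣ → ∣ E ∣) (b : ∣ E ∣) where
    private _≟_ = FinSet._≟_ E

    ∑⁻¹-cong : ∀ {f g : ∣ D ∣ → Carrier} → (∀ a → α a ≡ b → f a ≈ g a) →
               ∑⁻¹ D E α b f ≈ ∑⁻¹ D E α b g
    ∑⁻¹-cong f≈g = ∑-cong D λ a → when-cong (α a ≟ b) (f≈g a)

    ∑⁻¹-zero : ∀ {f : ∣ D ∣ → Carrier} → (∀ a → α a ≡ b → f a ≈ ε) →
               ∑⁻¹ D E α b f ≈ ε
    ∑⁻¹-zero f≈0 = ∑-zero D λ a →
      trans (when-cong (α a ≟ b) (f≈0 a)) (when-ε (α a ≟ b))

    ∑⁻¹-single : ∀ (f : ∣ D ∣ → Carrier) a → α a ≡ b →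
                 (∀ a′ → a′ ≢ a → f a′ ≈ ε) → ∑⁻¹ D E α b f ≈ f a
    ∑⁻¹-single f a αa≡b f≈0 = trans
      (∑-single D (λ a′ → when (α a′ ≟ b) (f a′)) a λ a′ a′≢a →
        trans (when-cong (α a′ ≟ b) λ _ → f≈0 a′ a′≢a) (when-ε (α a′ ≟ b)))
      (when-yes (α a ≟ b) αa≡b)

  ∑⁻¹-congᵅ : ∀ D E {α β : ∣ D ∣ → ∣ E ∣} → α ≗ β → ∀ b f →
              ∑⁻¹ D E α b f ≈ ∑⁻¹ D E β b f
  ∑⁻¹-congᵅ D E α≗β b f = ∑-cong D λ a →
    reflexive (≡.cong (λ e → when (FinSet._≟_ E e b) (f a)) (α≗β a))

  ∑⁻¹-id : ∀ D b f → ∑⁻¹ D D id b f ≈ f b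
  ∑⁻¹-id D b f = trans
    (∑-single D (λ a → when (a ≟ b) (f a)) b λ a → when-no (a ≟ b))
    (when-yes (b ≟ b) ≡.refl)
    where open FinSet D using (_≟_)

  ∑-∑⁻¹ : ∀ D E (α : ∣ D ∣ → ∣ E ∣) f → ∑ E (λ b → ∑⁻¹ D E α b f) ≈ ∑ D f
  ∑-∑⁻¹ D E α f = trans (∑-comm {m = FinSet.size E} {n = FinSet.size D} _)
    (∑-cong D λ a → trans
      (∑-single E (λ b → when (α a ≟ b) (f a)) (α a) λ b b≢αa →
        when-no (α a ≟ b) (b≢αa ∘ ≡.sym))
      (when-yes (α a ≟ α a) ≡.refl))
    where open FinSet E using (_≟_)

  ∑⁻¹-∘ : ∀ D E F (β : ∣ E ∣ → ∣ F ∣) (α : ∣ D ∣ → ∣ E ∣) d f →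
          ∑⁻¹ D F (β ∘ α) d f ≈ ∑⁻¹ E F β d (λ b → ∑⁻¹ D E α b f)
  ∑⁻¹-∘ D E F β α d f = begin
    ∑⁻¹ D F (β ∘ α) d f
      ≈⟨ ∑-∑⁻¹ D E α g ⟨
    ∑ E (λ b → ∑⁻¹ D E α b g)
      ≈⟨ ∑-cong E (λ b → go b (β b ≟ d)) ⟩
    ∑⁻¹ E F β d (λ b → ∑⁻¹ D E α b f)
      ∎
    where
    open FinSet F using (_≟_)
    g : ∣ D ∣ → Carrier
    g a = when (β (α a) ≟ d) (f a)
    go : ∀ b (βb≟d : Dec (β b ≡ d)) →
         ∑⁻¹ D E α b g ≈ when βb≟d (∑⁻¹ D E α b f)
    go b (yes βb≡d) = ∑⁻¹-cong D E α b {g} {f} λ a αa≡b →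
      when-yes (β (α a) ≟ d) (≡.trans (≡.cong β αa≡b) βb≡d)
    go b (no βb≢d) = ∑⁻¹-zero D E α b {g} λ a αa≡b →
      when-no (β (α a) ≟ d) λ βαa≡d →
        βb≢d (≡.trans (≡.sym (≡.cong β αa≡b)) βαa≡d)

------------------------------------------------------------------------
-- The ring ℤ_m: the integers with congruence modulo m as equality

record _≡_[mod_] (x y : ℤ) (m : ℕ) : Set where
  constructor congruent
  field m∣x-y : + m ∣ x ℤ.- y

infix 4 _≡_[mod_]

module _ (m : ℕ) where
  private
    subst : ∀ {x y} → x ≡ y → + m ∣ x → + m ∣ y
    subst = ≡.subst (+ m ∣_)

    mod-refl : ∀ {x y} → x ≡ y → x ≡ y [mod m ]
    mod-refl {x} ≡.refl = congruent (subst (≡.sym (ℤ.+-inverseʳ x)) (divides 0ℤ ≡.refl))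

    mod-sym : ∀ {x y} → x ≡ y [mod m ] → y ≡ x [mod m ]
    mod-sym {x} {y} (congruent p) = congruent (subst (lemma x y) (∣m⇒∣-m p))
      where
      lemma : ∀ x y → ℤ.- (x ℤ.- y) ≡ y ℤ.- x
      lemma = ℤSolver.solve-∀

    mod-trans : ∀ {x y z} → x ≡ y [mod m ] → y ≡ z [mod m ] → x ≡ z [mod m ]
    mod-trans {x} {y} {z} (congruent p) (congruent q) =
      congruent (subst (lemma x y z) (∣m∣n⇒∣m+n p q))
      where
      lemma : ∀ x y z → (x ℤ.- y) ℤ.+ (y ℤ.- z) ≡ x ℤ.- z
      lemma = ℤSolver.solve-∀

    +-cong : ∀ {x y u v} → x ≡ y [mod m ] → u ≡ v [mod m ] →
             x ℤ.+ u ≡ y ℤ.+ v [mod m ]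
    +-cong {x} {y} {u} {v} (congruent p) (congruent q) =
      congruent (subst (lemma x y u v) (∣m∣n⇒∣m+n p q))
      where
      lemma : ∀ x y u v → (x ℤ.- y) ℤ.+ (u ℤ.- v) ≡ (x ℤ.+ u) ℤ.- (y ℤ.+ v)
      lemma = ℤSolver.solve-∀

    *-cong : ∀ {x y u v} → x ≡ y [mod m ] → u ≡ v [mod m ] →
             x ℤ.* u ≡ y ℤ.* v [mod m ]
    *-cong {x} {y} {u} {v} (congruent p) (congruent q) =
      congruent (subst (lemma x y u v) (∣m∣n⇒∣m+n (∣m⇒∣m*n u p) (∣n⇒∣m*n y q)))
      where
      lemma : ∀ x y u v →
              (x ℤ.- y) ℤ.* u ℤ.+ y ℤ.* (u ℤ.- v) ≡ x ℤ.* u ℤ.- y ℤ.* v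
      lemma = ℤSolver.solve-∀

    neg-cong : ∀ {x y} → x ≡ y [mod m ] → ℤ.- x ≡ ℤ.- y [mod m ]
    neg-cong {x} {y} (congruent p) = congruent (subst (lemma x y) (∣m⇒∣-m p))
      where
      lemma : ∀ x y → ℤ.- (x ℤ.- y) ≡ ℤ.- x ℤ.- ℤ.- y
      lemma = ℤSolver.solve-∀

  ℤ/_ : CommutativeRing 0ℓ 0ℓ
  ℤ/_ = record
    { Carrier = ℤ
    ; _≈_ = _≡_[mod m ]
    ; _+_ = ℤ._+_
    ; _*_ = ℤ._*_
    ; -_ = ℤ.-_
    ; 0# = 0ℤ
    ; 1# = 1ℤ
    ; isCommutativeRing = record
      { isRing = record
        { +-isAbelianGroup = record
          { isGroup = record
            { isMonoid = record
              { isSemigroup = record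
                { isMagma = record
                  { isEquivalence = record
                    { refl = mod-refl ≡.refl ; sym = mod-sym ; trans = mod-trans }
                  ; ∙-cong = +-cong
                  }
                ; assoc = λ x y z → mod-refl (ℤ.+-assoc x y z)
                }
              ; identity = (λ x → mod-refl (ℤ.+-identityˡ x))
                         , (λ x → mod-refl (ℤ.+-identityʳ x))
              }
            ; inverse = (λ x → mod-refl (ℤ.+-inverseˡ x))
                      , (λ x → mod-refl (ℤ.+-inverseʳ x))
            ; ⁻¹-cong = neg-cong
            }
          ; comm = λ x y → mod-refl (ℤ.+-comm x y)
          }
        ; *-cong = *-cong
        ; *-assoc = λ x y z → mod-refl (ℤ.*-assoc x y z)
        ; *-identity = (λ x → mod-refl (ℤ.*-identityˡ x))
                     , (λ x → mod-refl (ℤ.*-identityʳ x))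
        ; distrib = (λ x y z → mod-refl (ℤ.*-distribˡ-+ x y z))
                  , (λ x y z → mod-refl (ℤ.*-distribʳ-+ x y z))
        }
      ; *-comm = λ x y → mod-refl (ℤ.*-comm x y)
      }
    }

------------------------------------------------------------------------
-- The minion 𝒵_m

module _ (m : ℕ) where
  open CommutativeRing (ℤ/ m)
  open FinSum +-commutativeMonoid

  record 𝒵-Element (D : FinSet) : Set where
    field
      f     : ∣ D ∣ → Carrier
      sum≈1 : ∑ D f ≈ 1#

  open 𝒵-Element

  𝒵 : Minion 0ℓ 0ℓ
  𝒵 = record
    { obj = λ D → record
      { Carrier = 𝒵-Element D
      ; _≈_ = λ x y → ∀ a → f x a ≈ f y a
      ; isEquivalence = record
        { refl = λ a → refl
        ; sym = λ x≈y a → sym (x≈y a)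
        ; trans = λ x≈y y≈z a → trans (x≈y a) (y≈z a)
        }
      }
    ; map = λ {D} {E} α → record
      { to = λ x → record
        { f = λ b → ∑⁻¹ D E α b (f x)
        ; sum≈1 = trans (∑-∑⁻¹ D E α (f x)) (sum≈1 x)
        }
      ; cong = λ x≈y b → ∑⁻¹-cong D E α b λ a _ → x≈y a
      }
    ; map-cong = λ {D} {E} α≗β x b → ∑⁻¹-congᵅ D E α≗β b (f x)
    ; map-id = λ {D} x b → ∑⁻¹-id D b (f x)
    ; map-∘ = λ {D} {E} {F} β α x d → ∑⁻¹-∘ D E F β α d (f x)
    }

------------------------------------------------------------------------
-- Vectors over ℤ_p

module Vectors (p : ℕ) where
  open CommutativeRing (ℤ/ p)
  open SemiringSum semiring using (sum)
  private variable N : ℕ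

  infixl 7 _⊙_
  infix 4 _≋_

  Vec : ℕ → Set
  Vec N = Vector Carrier N

  _≋_ : Vec N → Vec N → Set
  x ≋ y = ∀ j → x j ≈ y j

  𝟏 : Vec N
  𝟏 = replicate _ 1#

  𝔴 : Vec N → Carrier
  𝔴 = sum

  _⊙_ : Vec N → Vec N → Vec N
  _⊙_ = zipWith _*_

  ⨀ : ∀ {n} → Vector (Vec N) n → Vec N
  ⨀ = foldr _⊙_ 𝟏

  record IsSubspace (V : Pred (Vec N) 0ℓ) : Set where
    field
      resp : ∀ {x y} → x ≋ y → x ∈ V → y ∈ V
      0∈   : replicate _ 0# ∈ V
      +∈   : ∀ {x y} → x ∈ V → y ∈ V → zipWith _+_ x y ∈ V
      *∈   : ∀ r {x} → x ∈ V → (λ j → r * x j) ∈ V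

------------------------------------------------------------------------
-- The minion 𝒱_k-ℤ_p

module _ (k : ℕ) .{{_ : NonTrivial k}} (p : ℕ) (p-prime : Prime p) where
  open CommutativeRing (ℤ/ p) hiding (zero)
  open FinSum +-commutativeMonoid
  open SemiringSum semiring using (sum; sum-cong-≋; sum-replicate-zero; *-distribʳ-sum; ∑-comm)
  open Vectors p
  open import Relation.Binary.Reasoning.Setoid setoid
  import Algebra.Properties.CommutativeSemigroup *-commutativeSemigroup as *-CS

  record 𝒱-Structure (D : FinSet) (N : ℕ) : Set₁ where
    field
      V          : Pred (Vec N) 0ℓ
      isSubspace : IsSubspace V
      𝐢          : Vec N
      𝐢∈V        : 𝐢 ∈ V
      𝐯          : ∣ D ∣ → Vec N
      𝐯∈V        : ∀ a → 𝐯 a ∈ V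
      cond-i     : 𝐢 ≋ 𝟏 × 𝔴 𝐢 ≈ 1#
      cond-s     : (λ j → ∑ D λ a → 𝐯 a j) ≋ 𝐢
      cond-o     : ∀ {a b} → a ≢ b →
                   ∀ (𝐮 : Vector (Vec N) (k ℕ.∸ 2)) → (∀ l → 𝐮 l ∈ V) →
                   𝔴 (𝐯 a ⊙ 𝐯 b ⊙ ⨀ 𝐮) ≈ 0#
      cond-p     : ∀ a (𝐮 : Vector (Vec N) (k ℕ.∸ 2)) → (∀ l → 𝐮 l ∈ V) →
                   𝔴 (𝐯 a ⊙ 𝐯 a ⊙ ⨀ 𝐮) ≈ 𝔴 (𝐯 a ⊙ ⨀ 𝐮)

    open IsSubspace isSubspace public

  open 𝒱-Structure

  𝒱-Element : FinSet → Set₁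
  𝒱-Element D = Σ ℕ (𝒱-Structure D)

  -- Equality of triples (V , 𝐢 , 𝐯), including the ambient dimension.
  data _≈ⱽ_ {D : FinSet} : 𝒱-Element D → 𝒱-Element D → Set₁ where
    equal : ∀ {N} {S T : 𝒱-Structure D N} →
            V S ≐ V T → 𝐢 S ≋ 𝐢 T → (∀ a → 𝐯 S a ≋ 𝐯 T a) →
            (N , S) ≈ⱽ (N , T)

  ∑-∈ : ∀ {N n} {V : Pred (Vec N) 0ℓ} → IsSubspace V →
        (x : Vector (Vec N) n) → (∀ l → x l ∈ V) → (λ j → sum λ l → x l j) ∈ V
  ∑-∈ {n = ℕ.zero}  isV x x∈V = IsSubspace.0∈ isV
  ∑-∈ {n = ℕ.suc n} isV x x∈V =
    IsSubspace.+∈ isV (x∈V zero) (∑-∈ isV (x ∘ suc) (x∈V ∘ suc))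

  ∑⁻¹-∈ : ∀ {N} {V : Pred (Vec N) 0ℓ} → IsSubspace V →
          ∀ D E (α : ∣ D ∣ → ∣ E ∣) b (x : ∣ D ∣ → Vec N) → (∀ a → x a ∈ V) →
          (λ j → ∑⁻¹ D E α b λ a → x a j) ∈ V
  ∑⁻¹-∈ {N} {V} isV D E α b x x∈V =
    ∑-∈ isV (λ l j → when (FinSet._≟_ E (α (from l)) b) (x (from l) j))
            (λ l → go (x∈V (from l)) (FinSet._≟_ E (α (from l)) b))
    where
    open Inverse (FinSet.finite D) using (from)
    go : ∀ {P : Set} {y : Vec N} → y ∈ V → (d : Dec P) → (λ j → when d (y j)) ∈ V
    go y∈V (yes _) = y∈V
    go _   (no _)  = IsSubspace.0∈ isV

  𝔴-cong : ∀ {N} {x y : Vec N} → x ≋ y → 𝔴 x ≈ 𝔴 y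
  𝔴-cong = sum-cong-≋

  module Pushforward (D E : FinSet) (α : ∣ D ∣ → ∣ E ∣) {N : ℕ}
                     (x : ∣ D ∣ → Vec N) where
    x′ : ∣ E ∣ → Vec N
    x′ b j = ∑⁻¹ D E α b λ a → x a j

    𝔴-linear : ∀ b y → 𝔴 (x′ b ⊙ y) ≈ ∑⁻¹ D E α b λ a → 𝔴 (x a ⊙ y)
    𝔴-linear b y = begin
      𝔴 (x′ b ⊙ y)
        ≈⟨ sum-cong-≋ (λ j → *-distribʳ-sum (y j)
             λ l → when (α (from l) ≟ b) (x (from l) j)) ⟩
      sum (λ j → ∑ D λ a → when (α a ≟ b) (x a j) * y j)
        ≈⟨ ∑-comm {m = N} {n = FinSet.size D} _ ⟩
      ∑ D (λ a → sum λ j → when (α a ≟ b) (x a j) * y j)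
        ≈⟨ ∑-cong D (λ a → go (x a) (α a ≟ b)) ⟩
      ∑⁻¹ D E α b (λ a → 𝔴 (x a ⊙ y))
        ∎
      where
      open FinSet E using (_≟_)
      open Inverse (FinSet.finite D) using (from)
      go : ∀ {P : Set} (z : Vec N) (d : Dec P) →
           sum (λ j → when d (z j) * y j) ≈ when d (𝔴 (z ⊙ y))
      go z (yes _) = refl
      go z (no _)  = trans (sum-cong-≋ λ j → zeroˡ (y j)) (sum-replicate-zero N)

    𝔴-bilinear : ∀ b c y → 𝔴 (x′ b ⊙ x′ c ⊙ y) ≈
                 ∑⁻¹ D E α b λ a → ∑⁻¹ D E α c λ a′ → 𝔴 (x a ⊙ x a′ ⊙ y)
    𝔴-bilinear b c y = begin
      𝔴 (x′ b ⊙ x′ c ⊙ y)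
        ≈⟨ 𝔴-cong (λ j → *-assoc (x′ b j) (x′ c j) (y j)) ⟩
      𝔴 (x′ b ⊙ (x′ c ⊙ y))
        ≈⟨ 𝔴-linear b (x′ c ⊙ y) ⟩
      ∑⁻¹ D E α b (λ a → 𝔴 (x a ⊙ (x′ c ⊙ y)))
        ≈⟨ ∑⁻¹-cong D E α b (λ a _ → begin
             𝔴 (x a ⊙ (x′ c ⊙ y))
               ≈⟨ 𝔴-cong (λ j → *-CS.x∙yz≈y∙xz (x a j) (x′ c j) (y j)) ⟩
             𝔴 (x′ c ⊙ (x a ⊙ y))
               ≈⟨ 𝔴-linear c (x a ⊙ y) ⟩
             ∑⁻¹ D E α c (λ a′ → 𝔴 (x a′ ⊙ (x a ⊙ y)))
               ≈⟨ ∑⁻¹-cong D E α c (λ a′ _ → 𝔴-cong λ j →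
                    *-CS.x∙yz≈yx∙z (x a′ j) (x a j) (y j)) ⟩
             ∑⁻¹ D E α c (λ a′ → 𝔴 (x a ⊙ x a′ ⊙ y)) ∎) ⟩
      ∑⁻¹ D E α b (λ a → ∑⁻¹ D E α c λ a′ → 𝔴 (x a ⊙ x a′ ⊙ y))
        ∎

  map-structure : ∀ D E → (∣ D ∣ → ∣ E ∣) → ∀ {N} → 𝒱-Structure D N → 𝒱-Structure E N
  map-structure D E α S = record
    { V = V S
    ; isSubspace = isSubspace S
    ; 𝐢 = 𝐢 S
    ; 𝐢∈V = 𝐢∈V S
    ; 𝐯 = λ b j → ∑⁻¹ D E α b λ a → 𝐯 S a j
    ; 𝐯∈V = λ b → ∑⁻¹-∈ (isSubspace S) D E α b (𝐯 S) (𝐯∈V S)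
    ; cond-i = cond-i S
    ; cond-s = λ j → trans (∑-∑⁻¹ D E α (λ a → 𝐯 S a j)) (cond-s S j)
    ; cond-o = λ {b} {c} b≢c 𝐮 𝐮∈V → trans (𝔴-bilinear b c (⨀ 𝐮))
        (∑⁻¹-zero D E α b λ a αa≡b → ∑⁻¹-zero D E α c λ a′ αa′≡c →
          cond-o S (λ a≡a′ → b≢c (≡.trans (≡.sym αa≡b)
                                   (≡.trans (≡.cong α a≡a′) αa′≡c))) 𝐮 𝐮∈V)
    ; cond-p = λ b 𝐮 𝐮∈V → begin
        𝔴 (x′ b ⊙ x′ b ⊙ ⨀ 𝐮)
          ≈⟨ 𝔴-bilinear b b (⨀ 𝐮) ⟩
        ∑⁻¹ D E α b (λ a → ∑⁻¹ D E α b λ a′ → 𝔴 (𝐯 S a ⊙ 𝐯 S a′ ⊙ ⨀ 𝐮))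
          ≈⟨ ∑⁻¹-cong D E α b (λ a αa≡b → trans
               (∑⁻¹-single D E α b _ a αa≡b λ a′ a′≢a →
                 cond-o S (a′≢a ∘ ≡.sym) 𝐮 𝐮∈V)
               (cond-p S a 𝐮 𝐮∈V)) ⟩
        ∑⁻¹ D E α b (λ a → 𝔴 (𝐯 S a ⊙ ⨀ 𝐮))
          ≈⟨ 𝔴-linear b (⨀ 𝐮) ⟨
        𝔴 (x′ b ⊙ ⨀ 𝐮)
          ∎
    }
    where open Pushforward D E α (𝐯 S)

  𝒱 : Minion (lsuc 0ℓ) (lsuc 0ℓ)
  𝒱 = record
    { obj = λ D → record
      { Carrier = 𝒱-Element D
      ; _≈_ = _≈ⱽ_
      ; isEquivalence = record
        { refl = equal Unary.≐-refl (λ j → refl) (λ a j → refl)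
        ; sym = λ { (equal V≐ 𝐢≋ 𝐯≋) →
            equal (Unary.≐-sym V≐) (λ j → sym (𝐢≋ j)) (λ a j → sym (𝐯≋ a j)) }
        ; trans = λ { (equal V≐ 𝐢≋ 𝐯≋) (equal V≐′ 𝐢≋′ 𝐯≋′) →
            equal (Unary.≐-trans V≐ V≐′)
                  (λ j → trans (𝐢≋ j) (𝐢≋′ j))
                  (λ a j → trans (𝐯≋ a j) (𝐯≋′ a j)) }
        }
      }
    ; map = λ {D} {E} α → record
      { to = λ (N , S) → N , map-structure D E α S
      ; cong = λ { (equal V≐ 𝐢≋ 𝐯≋) →
          equal V≐ 𝐢≋ λ b j → ∑⁻¹-cong D E α b λ a _ → 𝐯≋ a j }
      }
    ; map-cong = λ {D} {E} α≗β (N , S) → equal Unary.≐-refl (λ j → refl)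
        λ b j → ∑⁻¹-congᵅ D E α≗β b λ a → 𝐯 S a j
    ; map-id = λ {D} (N , S) → equal Unary.≐-refl (λ j → refl)
        λ b j → ∑⁻¹-id D b λ a → 𝐯 S a j
    ; map-∘ = λ {D} {E} {F} β α (N , S) → equal Unary.≐-refl (λ j → refl)
        λ d j → ∑⁻¹-∘ D E F β α d λ a → 𝐯 S a j
    }

{-# OPTIONS --safe #-}

-- Write F(x) = Σⱼ xⱼᵖ mod p², which depends only on x mod p.  By the binomial
-- theorem, F(x + y) − F(x) − F(y) is a combination of the 𝔴(xⁱyᵖ⁻ⁱ), 0 < i < p,
-- with coefficients divisible by p, and xⁱyᵖ⁻ⁱ = x ⊙ y ⊙ xⁱ⁻¹ ⊙ yᵖ⁻ⁱ⁻¹ is x ⊙ y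
-- times p − 2 further elements of V.  So by (o) F is additive on sums of the
-- 𝐯(a), and a ↦ F(𝐯(a)) commutes with the minion maps.  Its total F(𝐢) is only
-- known to be 1 mod p, so we multiply by 2 − F(𝐢), the inverse of F(𝐢) mod p².

module Submission where

open import Defs
open import Algebra.Bundles using (CommutativeRing)
open import Data.Fin.Base using (Fin; zero; suc; toℕ; inject₁; fromℕ)
import Data.Fin.Properties as Fin
open import Data.Integer.Base as ℤ using (ℤ; +_; 0ℤ; 1ℤ)
open import Data.Integer.Divisibility.Signed
import Data.Integer.Properties as ℤ
import Data.Integer.Tactic.RingSolver as ℤSolver
open import Data.Nat.Base as ℕ using (ℕ; _^_; _!; _<_; _≤_; NonTrivial)
open import Data.Nat.Combinatorics using (_C_; k![n∸k]!∣n!; nCk≡n!/k![n-k]!; nCn≡1)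
import Data.Nat.Divisibility as ℕ
import Data.Nat.DivMod as ℕ
import Data.Nat.Properties as ℕ
open import Data.Nat.Primality
  using (Prime; prime⇒nonTrivial; euclidsLemma; ¬prime[0]; ¬prime[1])
open import Data.Product.Base using (_,_; proj₁; proj₂)
open import Data.Sum.Base using (inj₁; inj₂)
open import Data.Vec.Functional using (Vector; _∷_; zipWith; replicate; init; last; tail)
open import Function.Base using (_∘_)
open import Function.Bundles using (Injection; Inverse)
open import Function.Properties.Inverse using (↔⇒↣; ↔-sym)
open import Level using (0ℓ)
open import Relation.Binary.PropositionalEquality as ≡
  using (_≡_; _≢_; refl; cong; cong₂; sym; trans; module ≡-Reasoning)
import Relation.Binary.Reasoning.Setoid as SetoidReasoning
open import Relation.Nullary using (¬_; Dec; yes; no; contradiction)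
open import Relation.Unary using (Pred; _∈_)

open import Algebra.Properties.CommutativeSemiring.Binomial ℤ.+-*-commutativeSemiring
  using (binomialTerm) renaming (theorem to binomial-theorem)
open import Algebra.Properties.Semiring.Exp ℤ.+-*-semiring
  using () renaming (_^_ to _^ᶻ_)
open import Algebra.Properties.Semiring.Mult ℤ.+-*-semiring
  using (_×_)
open import Algebra.Properties.Semiring.Sum ℤ.+-*-semiring
  using (sum; sum-cong-≗; sum-init-last; ∑-comm; ∑-distrib-+; *-distribˡ-sum; sum-replicate-zero)

private variable
  m n p N : ℕ

-- Binomial coefficients modulo a prime.

prime∤! : Prime p → ∀ k → k < p → ¬ (p ℕ.∣ k !)
prime∤! p-prime ℕ.zero 0<p p∣1 =
  ¬prime[1] (≡.subst Prime (ℕ.∣1⇒≡1 p∣1) p-prime)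
prime∤! p-prime (ℕ.suc k) k<p p∣k! with euclidsLemma (ℕ.suc k) (k !) p-prime p∣k!
... | inj₁ p∣1+k = ℕ.>⇒∤ k<p p∣1+k
... | inj₂ p∣k!′ = prime∤! p-prime k (ℕ.<-trans (ℕ.n<1+n k) k<p) p∣k!′

nCk*k![n∸k]!≡n! : ∀ {n k} → k ≤ n → (n C k) ℕ.* (k ! ℕ.* (n ℕ.∸ k) !) ≡ n !
nCk*k![n∸k]!≡n! {n} {k} k≤n = trans
  (cong (ℕ._* (k ! ℕ.* (n ℕ.∸ k) !)) (nCk≡n!/k![n-k]! k≤n))
  (ℕ.m/n*n≡m {{ℕ._!*_!≢0 k (n ℕ.∸ k)}} (k![n∸k]!∣n! k≤n))

-- The product of `p C k`, `k !` and `(p ∸ k) !` is `p !`, which `p` divides; both factorials have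
-- only factors below `p`.
prime∣C : Prime p → ∀ {k} → 0 < k → k < p → p ℕ.∣ (p C k)
prime∣C {ℕ.zero}  p-prime _ ()
prime∣C {p@(ℕ.suc n)} p-prime {k} 0<k k<p
  with euclidsLemma (p C k) _ p-prime
         (≡.subst (p ℕ.∣_) (sym (nCk*k![n∸k]!≡n! (ℕ.<⇒≤ k<p))) (ℕ.m∣m*n (n !)))
... | inj₁ p∣C = p∣C
... | inj₂ p∣k!*[p∸k]! with euclidsLemma (k !) _ p-prime p∣k!*[p∸k]!
...   | inj₁ p∣k!     = contradiction p∣k! (prime∤! p-prime k k<p)
...   | inj₂ p∣[p∸k]! = contradiction p∣[p∸k]!
        (prime∤! p-prime (p ℕ.∸ k) (ℕ.∸-monoʳ-< 0<k (ℕ.<⇒≤ k<p)))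

-- Divisibility and congruence of integer sums, products and powers.

×≡* : ∀ n x → n × x ≡ + n ℤ.* x
×≡* ℕ.zero    x = refl
×≡* (ℕ.suc n) x = trans (cong (ℤ._+_ x) (×≡* n x)) (sym (ℤ.suc-* (+ n) x))

∣-sum : ∀ {d} (f : Vector ℤ n) → (∀ i → d ∣ f i) → d ∣ sum f
∣-sum {ℕ.zero}  f d∣f = divides 0ℤ refl
∣-sum {ℕ.suc n} f d∣f = ∣m∣n⇒∣m+n (d∣f zero) (∣-sum (f ∘ suc) (d∣f ∘ suc))

^2∣* : ∀ {x y} → + m ∣ x → + m ∣ y → + (m ^ 2) ∣ x ℤ.* y
^2∣* {m} (divides q refl) (divides r refl) = divides (q ℤ.* r) (begin
  (q ℤ.* + m) ℤ.* (r ℤ.* + m)  ≡⟨ lemma q r (+ m) ⟩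
  (q ℤ.* r) ℤ.* (+ m ℤ.* + m)  ≡⟨ cong (q ℤ.* r ℤ.*_) (ℤ.pos-* m m) ⟨
  (q ℤ.* r) ℤ.* + (m ℕ.* m)    ≡⟨ cong (λ k → (q ℤ.* r) ℤ.* + (m ℕ.* k)) (ℕ.*-identityʳ m) ⟨
  (q ℤ.* r) ℤ.* + (m ^ 2)      ∎)
  where
  open ≡-Reasoning
  lemma : ∀ q r a → (q ℤ.* a) ℤ.* (r ℤ.* a) ≡ (q ℤ.* r) ℤ.* (a ℤ.* a)
  lemma = ℤSolver.solve-∀

^2∣^ : ∀ n .{{_ : NonTrivial n}} {x} → + m ∣ x → + (m ^ 2) ∣ x ^ᶻ n
^2∣^ (ℕ.suc (ℕ.suc n)) {x} m∣x = ^2∣* m∣x (∣m⇒∣m*n (x ^ᶻ n) m∣x)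

∣⇒≡0 : ∀ {x} → + m ∣ x → x ≡ 0ℤ [mod m ]
∣⇒≡0 {m} {x} m∣x = congruent (≡.subst (+ m ∣_) (sym (ℤ.+-identityʳ x)) m∣x)

≡0⇒∣ : ∀ {x} → x ≡ 0ℤ [mod m ] → + m ∣ x
≡0⇒∣ {m} {x} (congruent m∣x-0) = ≡.subst (+ m ∣_) (ℤ.+-identityʳ x) m∣x-0

^≡1 : ∀ n {x} → x ≡ 1ℤ [mod m ] → x ^ᶻ n ≡ 1ℤ [mod m ]
^≡1 {m} ℕ.zero    x≡1 = CommutativeRing.refl (ℤ/ m)
^≡1 {m} (ℕ.suc n) x≡1 = CommutativeRing.*-cong (ℤ/ m) x≡1 (^≡1 n x≡1)

-- Sums of `p`-th powers modulo `p ^ 2`.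

powerSum : ℕ → Vector ℤ N → ℤ
powerSum p x = sum λ l → x l ^ᶻ p

powerSum-zero : ∀ p .{{_ : NonTrivial p}} N → powerSum p (replicate N 0ℤ) ≡ 0ℤ
powerSum-zero (ℕ.suc (ℕ.suc _)) N = sum-replicate-zero N

-- Each mixed term of the binomial expansion gets one factor `p` from its coefficient and a second
-- from the hypothesis. The hypothesis is stated as divisibility of the mixed sums so that it covers
-- both orthogonal `x`, `y` and a `y` divisible by `p`.
powerSum-+ : Prime p → (x y : Vector ℤ N) →
  (∀ i j → ℕ.suc i ℕ.+ ℕ.suc j ≡ p → + p ∣ sum (λ l → x l ^ᶻ ℕ.suc i ℤ.* y l ^ᶻ ℕ.suc j)) →
  powerSum p (zipWith ℤ._+_ x y) ≡ powerSum p x ℤ.+ powerSum p y [mod p ^ 2 ]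
powerSum-+ {ℕ.zero} p-prime = contradiction p-prime ¬prime[0]
powerSum-+ {p@(ℕ.suc n)} {N} p-prime x y mixed∣ =
  congruent (≡.subst (+ (p ^ 2) ∣_) (sym difference) p²∣middle)
  where
  t : Fin (ℕ.suc p) → ℤ
  t k = sum λ l → binomialTerm (x l) (y l) p k

  -- Dropping the first and last terms of the expansion leaves the indices from 1 to `p - 1`.
  middle : Fin n → ℤ
  middle = init (tail t)

  first≡ : t zero ≡ powerSum p y
  first≡ = sum-cong-≗ λ l → trans (ℤ.+-identityʳ _) (ℤ.*-identityˡ (y l ^ᶻ p))

  last≡ : last (tail t) ≡ powerSum p x
  last≡ = sum-cong-≗ term
    where
    term : ∀ l → binomialTerm (x l) (y l) p (suc (fromℕ n)) ≡ x l ^ᶻ p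
    term l rewrite Fin.toℕ-fromℕ n | nCn≡1 p | ℕ.n∸n≡0 n =
      trans (ℤ.+-identityʳ _) (ℤ.*-identityʳ (x l ^ᶻ p))

  p²∣middle : + (p ^ 2) ∣ sum middle
  p²∣middle = ∣-sum middle term
    where
    term : ∀ i → + (p ^ 2) ∣ middle i
    term i = ≡.subst (+ (p ^ 2) ∣_) (sym middle≡)
      (^2∣* (∣ᵤ⇒∣ {+ p} {+ (p C ℕ.suc k)} (prime∣C p-prime (ℕ.s≤s ℕ.z≤n) (ℕ.s≤s (Fin.toℕ<n i))))
            (mixed∣ k j (trans (ℕ.+-suc (ℕ.suc k) j) (cong ℕ.suc (ℕ.m+[n∸m]≡n (Fin.toℕ<n i))))))
      where
      k j : ℕ
      k = toℕ i
      -- As `p` is `suc n`, the exponent of `y` is `n ∸ k`, which equals `suc j` because `k < n`.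
      j = n ℕ.∸ ℕ.suc k
      middle≡ : middle i ≡ + (p C ℕ.suc k) ℤ.* sum (λ l → x l ^ᶻ ℕ.suc k ℤ.* y l ^ᶻ ℕ.suc j)
      k≡ : toℕ (inject₁ i) ≡ k
      k≡ = Fin.toℕ-inject₁ i
      1+j≡ : n ℕ.∸ toℕ (inject₁ i) ≡ ℕ.suc j
      1+j≡ = trans (cong (n ℕ.∸_) k≡) (ℕ.+-∸-assoc 1 (Fin.toℕ<n i))
      middle≡ = trans
        (sum-cong-≗ λ l → trans
          (cong₂ (λ a b → (p C ℕ.suc a) × (x l ^ᶻ ℕ.suc a ℤ.* y l ^ᶻ b)) k≡ 1+j≡)
          (×≡* (p C ℕ.suc k) (x l ^ᶻ ℕ.suc k ℤ.* y l ^ᶻ ℕ.suc j)))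
        (sym (*-distribˡ-sum (+ (p C ℕ.suc k)) λ l → x l ^ᶻ ℕ.suc k ℤ.* y l ^ᶻ ℕ.suc j))

  difference : powerSum p (zipWith ℤ._+_ x y) ℤ.- (powerSum p x ℤ.+ powerSum p y) ≡ sum middle
  difference = begin
    powerSum p (zipWith ℤ._+_ x y) ℤ.- (powerSum p x ℤ.+ powerSum p y)
      ≡⟨ cong (ℤ._- (powerSum p x ℤ.+ powerSum p y)) (begin
           powerSum p (zipWith ℤ._+_ x y)
             ≡⟨ sum-cong-≗ (λ l → binomial-theorem p (x l) (y l)) ⟩
           (sum λ l → sum λ k → binomialTerm (x l) (y l) p k)
             ≡⟨ ∑-comm (λ l k → binomialTerm (x l) (y l) p k) ⟩
           t zero ℤ.+ sum (tail t)
             ≡⟨ cong₂ ℤ._+_ first≡ (trans (sum-init-last (tail t)) (cong (λ s → sum middle ℤ.+ s) last≡)) ⟩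
           powerSum p y ℤ.+ (sum middle ℤ.+ powerSum p x) ∎) ⟩
    powerSum p y ℤ.+ (sum middle ℤ.+ powerSum p x) ℤ.- (powerSum p x ℤ.+ powerSum p y)
      ≡⟨ lemma (powerSum p x) (powerSum p y) (sum middle) ⟩
    sum middle ∎
    where
    open ≡-Reasoning
    lemma : ∀ a b c → b ℤ.+ (c ℤ.+ a) ℤ.- (a ℤ.+ b) ≡ c
    lemma = ℤSolver.solve-∀

-- Write `x` as `y + d` with `d` divisible by `p`: every mixed term contains `d`, and the `p`-th
-- powers of the entries of `d` are divisible by `p ^ 2` since `p` is at least 2. Hence
-- `powerSum p`, computed on integer representatives, is well defined on vectors over `ℤ/ p`.
powerSum-cong : Prime p → {x y : Vector ℤ N} → (∀ l → x l ≡ y l [mod p ]) →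
                powerSum p x ≡ powerSum p y [mod p ^ 2 ]
powerSum-cong {p} {N} p-prime {x} {y} x≋y = begin
  powerSum p x                      ≡⟨ sum-cong-≗ (λ l → cong (_^ᶻ p) (y+d≡x (x l) (y l))) ⟨
  powerSum p (zipWith ℤ._+_ y d)    ≈⟨ powerSum-+ p-prime y d (λ i j _ → ∣-sum _ λ l →
                                         ∣n⇒∣m*n (y l ^ᶻ ℕ.suc i) (∣m⇒∣m*n (d l ^ᶻ j) (p∣d l))) ⟩
  powerSum p y ℤ.+ powerSum p d     ≈⟨ +-congˡ {x = powerSum p y} (∣⇒≡0 (∣-sum (λ l → d l ^ᶻ p) λ l → ^2∣^ p (p∣d l))) ⟩
  powerSum p y ℤ.+ 0ℤ               ≡⟨ ℤ.+-identityʳ _ ⟩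
  powerSum p y                      ∎
  where
  open CommutativeRing (ℤ/ (p ^ 2)) using (setoid; +-congˡ)
  open SetoidReasoning setoid
  instance _ = prime⇒nonTrivial p-prime
  d : Vector ℤ N
  d l = x l ℤ.- y l
  p∣d : ∀ l → + p ∣ d l
  p∣d l = _≡_[mod_].m∣x-y (x≋y l)
  y+d≡x : ∀ x y → y ℤ.+ (x ℤ.- y) ≡ x
  y+d≡x = ℤSolver.solve-∀

-- Orthogonal vectors and additivity of power sums.

module Orthogonality (p : ℕ) {N : ℕ} {V : Pred (Vectors.Vec p N) 0ℓ}
                     (V-subspace : Vectors.IsSubspace p V) where
  open Vectors p
  open IsSubspace V-subspace
  open CommutativeRing (ℤ/ p) using (_≈_; setoid; +-cong)

  -- For `k = p ∸ 2` this is the conclusion of condition (o). As a relation on arbitrary vectors it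
  -- extends to zero vectors and to sums.
  Orthogonal : ℕ → Vec N → Vec N → Set
  Orthogonal k x y = ∀ (𝐮 : Vector (Vec N) k) → (∀ l → 𝐮 l ∈ V) → 𝔴 (x ⊙ y ⊙ ⨀ 𝐮) ≈ 0ℤ

  private variable
    k : ℕ
    x y z : Vec N

  orthogonal-0ʳ : ∀ x → Orthogonal k x (replicate N 0ℤ)
  orthogonal-0ʳ x 𝐮 _ = ∣⇒≡0 (∣-sum (x ⊙ replicate N 0ℤ ⊙ ⨀ 𝐮) λ j →
    divides 0ℤ (cong (ℤ._* ⨀ 𝐮 j) (ℤ.*-zeroʳ (x j))))

  orthogonal-0ˡ : ∀ y → Orthogonal k (replicate N 0ℤ) y
  orthogonal-0ˡ y 𝐮 _ = ∣⇒≡0 (∣-sum (replicate N 0ℤ ⊙ y ⊙ ⨀ 𝐮) λ j → divides 0ℤ refl)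

  orthogonal-+ʳ : Orthogonal k x y → Orthogonal k x z → Orthogonal k x (zipWith ℤ._+_ y z)
  orthogonal-+ʳ {x = x} {y} {z} x⊥y x⊥z 𝐮 𝐮∈V = begin
    𝔴 (x ⊙ zipWith ℤ._+_ y z ⊙ ⨀ 𝐮)
      ≡⟨ sum-cong-≗ (λ j → lemma (x j) (y j) (z j) (⨀ 𝐮 j)) ⟩
    𝔴 (zipWith ℤ._+_ (x ⊙ y ⊙ ⨀ 𝐮) (x ⊙ z ⊙ ⨀ 𝐮))
      ≡⟨ ∑-distrib-+ (x ⊙ y ⊙ ⨀ 𝐮) (x ⊙ z ⊙ ⨀ 𝐮) ⟩
    𝔴 (x ⊙ y ⊙ ⨀ 𝐮) ℤ.+ 𝔴 (x ⊙ z ⊙ ⨀ 𝐮)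
      ≈⟨ +-cong (x⊥y 𝐮 𝐮∈V) (x⊥z 𝐮 𝐮∈V) ⟩
    0ℤ ∎
    where
    open SetoidReasoning setoid
    lemma : ∀ x y z u → x ℤ.* (y ℤ.+ z) ℤ.* u ≡ x ℤ.* y ℤ.* u ℤ.+ x ℤ.* z ℤ.* u
    lemma = ℤSolver.solve-∀

  orthogonal-sumʳ : ∀ x (ys : Vector (Vec N) n) → (∀ l → Orthogonal k x (ys l)) →
                    Orthogonal k x (λ j → sum λ l → ys l j)
  orthogonal-sumʳ {ℕ.zero}  x ys x⊥ys = orthogonal-0ʳ x
  orthogonal-sumʳ {ℕ.suc n} x ys x⊥ys =
    orthogonal-+ʳ {x = x} {ys zero} {λ j → sum λ l → ys (suc l) j}
      (x⊥ys zero) (orthogonal-sumʳ x (ys ∘ suc) (x⊥ys ∘ suc))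

  copies : Vec N → Vec N → ∀ i j → Vector (Vec N) (i ℕ.+ j)
  copies x y ℕ.zero    j = replicate j y
  copies x y (ℕ.suc i) j = x ∷ copies x y i j

  copies∈ : x ∈ V → y ∈ V → ∀ i j l → copies x y i j l ∈ V
  copies∈ x∈V y∈V ℕ.zero    j l       = y∈V
  copies∈ x∈V y∈V (ℕ.suc i) j zero    = x∈V
  copies∈ x∈V y∈V (ℕ.suc i) j (suc l) = copies∈ x∈V y∈V i j l

  ⨀-copies : ∀ x y i j l → ⨀ (copies x y i j) l ≡ x l ^ᶻ i ℤ.* y l ^ᶻ j
  ⨀-copies x y ℕ.zero ℕ.zero l = refl
  ⨀-copies x y ℕ.zero (ℕ.suc j) l = trans
    (cong (y l ℤ.*_) (trans (⨀-copies x y ℕ.zero j l) (ℤ.*-identityˡ _)))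
    (sym (ℤ.*-identityˡ _))
  ⨀-copies x y (ℕ.suc i) j l = trans
    (cong (x l ℤ.*_) (⨀-copies x y i j l))
    (sym (ℤ.*-assoc (x l) (x l ^ᶻ i) (y l ^ᶻ j)))

  -- Pulling one `x` and one `y` out of the monomial leaves `i` copies of `x` and `j` copies of `y`;
  -- these lie in `V` and can serve as `𝐮`.
  orthogonal⇒mixed∣ : x ∈ V → y ∈ V → Orthogonal k x y → ∀ i j → i ℕ.+ j ≡ k →
                      + p ∣ sum λ l → x l ^ᶻ ℕ.suc i ℤ.* y l ^ᶻ ℕ.suc j
  orthogonal⇒mixed∣ {x} {y} x∈V y∈V x⊥y i j refl = ≡.subst (+ p ∣_)
    (sum-cong-≗ λ l → trans
      (cong (x l ℤ.* y l ℤ.*_) (⨀-copies x y i j l))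
      (lemma (x l) (y l) (x l ^ᶻ i) (y l ^ᶻ j)))
    (≡0⇒∣ (x⊥y (copies x y i j) (copies∈ x∈V y∈V i j)))
    where
    lemma : ∀ x y a b → x ℤ.* y ℤ.* (a ℤ.* b) ≡ x ℤ.* a ℤ.* (y ℤ.* b)
    lemma = ℤSolver.solve-∀

  -- Induction on the number of vectors: the first is orthogonal to the sum of the others, and that
  -- sum stays in the subspace `V`, so its copies may again serve as `𝐮`.
  powerSum-sum : Prime p → (xs : Vector (Vec N) n) → (∀ l → xs l ∈ V) →
    (∀ {l l′} → l ≢ l′ → Orthogonal (p ℕ.∸ 2) (xs l) (xs l′)) →
    powerSum p (λ j → sum λ l → xs l j) ≡ sum (λ l → powerSum p (xs l)) [mod p ^ 2 ]
  powerSum-sum {ℕ.zero} p-prime xs _ _ =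
    CommutativeRing.reflexive (ℤ/ (p ^ 2)) (powerSum-zero p N)
    where instance _ = prime⇒nonTrivial p-prime
  powerSum-sum {ℕ.suc n} p-prime xs xs∈V xs⊥ = begin
    powerSum p (zipWith ℤ._+_ (xs zero) rest)
      ≈⟨ powerSum-+ p-prime (xs zero) rest (λ i j i+j+2≡p →
           orthogonal⇒mixed∣ (xs∈V zero) (∑-∈ p p p-prime V-subspace (xs ∘ suc) (xs∈V ∘ suc))
             (orthogonal-sumʳ (xs zero) (xs ∘ suc) λ l → xs⊥ {zero} {suc l} λ ())
             -- The exponents `suc i` and `suc j` add up to `p`; without the two factors pulled out,
             -- `p ∸ 2` remain, the length of `𝐮` in (o).
             i j (cong (ℕ._∸ 2) (trans (cong ℕ.suc (sym (ℕ.+-suc i j))) i+j+2≡p))) ⟩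
    powerSum p (xs zero) ℤ.+ powerSum p rest
      ≈⟨ +-congˡ {x = powerSum p (xs zero)} (powerSum-sum p-prime (xs ∘ suc) (xs∈V ∘ suc)
           λ {l} {l′} l≢l′ → xs⊥ {suc l} {suc l′} (l≢l′ ∘ Fin.suc-injective)) ⟩
    sum (λ l → powerSum p (xs l)) ∎
    where
    instance _ = prime⇒nonTrivial p-prime
    open CommutativeRing (ℤ/ (p ^ 2)) using (+-congˡ) renaming (setoid to setoid²)
    open SetoidReasoning setoid²
    rest : Vec N
    rest j = sum λ l → xs (suc l) j

-- The weights modulo `p ^ 2` that define the homomorphism.

module Weight (p : ℕ) (p-prime : Prime p) where
  private instance _ = prime⇒nonTrivial p-prime
  open Vectors p
  private
    module ℤ/p  = CommutativeRing (ℤ/ p)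
    module ℤ/p² = CommutativeRing (ℤ/ (p ^ 2))
    module Σp   = FinSum ℤ/p.+-commutativeMonoid
  open FinSum ℤ/p².+-commutativeMonoid
  open FinSet using (∣_∣)
  open 𝒱-Structure

  -- Carries distinctness from indices, as in `powerSum-sum`, to elements of `D`, as in `cond-o`.
  from-injective : ∀ D {l l′} →
                   Inverse.from (FinSet.finite D) l ≡ Inverse.from (FinSet.finite D) l′ → l ≡ l′
  from-injective D = Injection.injective (↔⇒↣ (↔-sym (FinSet.finite D)))

  private variable D : FinSet

  -- When F ≡ 1 mod p, 2 − F is inverse to F mod p², as (2 − F) F − 1 = − (F − 1)².
  scale : 𝒱-Structure p p p-prime D N → ℤ
  scale S = + 2 ℤ.- powerSum p (𝐢 S)

  weight : 𝒱-Structure p p p-prime D N → ∣ D ∣ → ℤ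
  weight S a = scale S ℤ.* powerSum p (𝐯 S a)

  -- The entries of `𝐢` are 1 modulo `p`, hence so are their `p`-th powers. Thus `powerSum p (𝐢 S)`
  -- and `𝔴 (𝐢 S)` both count the coordinates modulo `p`, and the latter is 1 by (i).
  powerSum-𝐢≡1 : (S : 𝒱-Structure p p p-prime D N) → powerSum p (𝐢 S) ≡ 1ℤ [mod p ]
  powerSum-𝐢≡1 {N = N} S = begin
    powerSum p (𝐢 S)  ≈⟨ 𝔴-cong p p p-prime (λ j → ^≡1 p (proj₁ (cond-i S) j)) ⟩
    𝔴 (𝟏 {N})         ≈⟨ 𝔴-cong p p p-prime (proj₁ (cond-i S)) ⟨
    𝔴 (𝐢 S)           ≈⟨ proj₂ (cond-i S) ⟩
    1ℤ                ∎
    where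
    open SetoidReasoning ℤ/p.setoid

  scale-inverse : (S : 𝒱-Structure p p p-prime D N) →
                  scale S ℤ.* powerSum p (𝐢 S) ≡ 1ℤ [mod p ^ 2 ]
  scale-inverse S = congruent (≡.subst (+ (p ^ 2) ∣_) (lemma (powerSum p (𝐢 S)))
    (∣m⇒∣-m (^2∣* p∣F-1 p∣F-1)))
    where
    p∣F-1 : + p ∣ powerSum p (𝐢 S) ℤ.- 1ℤ
    p∣F-1 = _≡_[mod_].m∣x-y (powerSum-𝐢≡1 S)
    lemma : ∀ x → ℤ.- ((x ℤ.- 1ℤ) ℤ.* (x ℤ.- 1ℤ)) ≡ (+ 2 ℤ.- x) ℤ.* x ℤ.- 1ℤ
    lemma = ℤSolver.solve-∀

  weight-sum : (S : 𝒱-Structure p p p-prime D N) → ∑ D (weight S) ≡ 1ℤ [mod p ^ 2 ]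
  weight-sum {D} S = begin
    ∑ D (weight S)
      ≡⟨ *-distribˡ-sum (scale S) (λ l → powerSum p (𝐯 S (from l))) ⟨
    scale S ℤ.* ∑ D (λ a → powerSum p (𝐯 S a))
      ≈⟨ ℤ/p².*-congˡ {scale S} (powerSum-sum p-prime (𝐯 S ∘ from) (𝐯∈V S ∘ from)
           λ l≢l′ → cond-o S (l≢l′ ∘ from-injective D)) ⟨
    scale S ℤ.* powerSum p (λ j → ∑ D λ a → 𝐯 S a j)
      -- The equation (s) holds modulo `p`; taking `p`-th powers lifts it to `p ^ 2`.
      ≈⟨ ℤ/p².*-congˡ {scale S} (powerSum-cong p-prime (cond-s S)) ⟩
    scale S ℤ.* powerSum p (𝐢 S)
      ≈⟨ scale-inverse S ⟩
    1ℤ ∎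
    where
    open SetoidReasoning ℤ/p².setoid
    open Inverse (FinSet.finite D) using (from)
    open Orthogonality p (isSubspace S)

  -- The minion map keeps `𝐢`, so the scale is unchanged, and it replaces the vectors by sums over
  -- fibres, on which orthogonality makes the power sum additive.
  weight-natural : ∀ {D E} (α : ∣ D ∣ → ∣ E ∣) (S : 𝒱-Structure p p p-prime D N) b →
    weight (map-structure p p p-prime D E α S) b ≡ ∑⁻¹ D E α b (weight S) [mod p ^ 2 ]
  weight-natural {N = N} {D} {E} α S b = begin
    scale S ℤ.* powerSum p (λ j → sum λ l → fibre l j)
      ≈⟨ ℤ/p².*-congˡ {scale S} (powerSum-sum p-prime fibre (λ l → fibre∈V l (α (from l) ≟ b))
           λ {l} {l′} l≢l′ → fibre⊥ l≢l′ (α (from l) ≟ b) (α (from l′) ≟ b)) ⟩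
    scale S ℤ.* sum (λ l → powerSum p (fibre l))
      ≡⟨ *-distribˡ-sum (scale S) (λ l → powerSum p (fibre l)) ⟩
    sum (λ l → scale S ℤ.* powerSum p (fibre l))
      ≡⟨ sum-cong-≗ (λ l → scale-when (𝐯 S (from l)) (α (from l) ≟ b)) ⟩
    ∑⁻¹ D E α b (weight S) ∎
    where
    open SetoidReasoning ℤ/p².setoid
    open FinSet E using (_≟_)
    open Inverse (FinSet.finite D) using (from)
    open Orthogonality p (isSubspace S)

    -- Indices outside the fibre carry the zero vector, which lies in `V` and is orthogonal to every
    -- vector, so `powerSum-sum` applies to the family indexed by all of `D`.
    fibre : Vector (Vec N) (FinSet.size D)
    fibre l j = Σp.when (α (from l) ≟ b) (𝐯 S (from l) j)

    fibre∈V : ∀ l {P : Set} (d : Dec P) → (λ j → Σp.when d (𝐯 S (from l) j)) ∈ V S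
    fibre∈V l (yes _) = 𝐯∈V S (from l)
    fibre∈V l (no _)  = 0∈ S

    fibre⊥ : ∀ {l l′} → l ≢ l′ → ∀ {P Q : Set} (d : Dec P) (e : Dec Q) →
             Orthogonal (p ℕ.∸ 2) (λ j → Σp.when d (𝐯 S (from l) j))
                                  (λ j → Σp.when e (𝐯 S (from l′) j))
    fibre⊥ l≢l′ (yes _) (yes _) = cond-o S (l≢l′ ∘ from-injective D)
    fibre⊥ {l′ = l′} _ (no _) e = orthogonal-0ˡ (λ j → Σp.when e (𝐯 S (from l′) j))
    fibre⊥ {l} _ (yes _) (no _) = orthogonal-0ʳ (𝐯 S (from l))

    scale-when : ∀ x {P : Set} (d : Dec P) →
      scale S ℤ.* powerSum p (λ j → Σp.when d (x j)) ≡ when d (scale S ℤ.* powerSum p x)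
    scale-when x (yes _) = refl
    scale-when x (no _)  = trans (cong (scale S ℤ.*_) (powerSum-zero p N)) (ℤ.*-zeroʳ (scale S))

proposition4p6 : (p : ℕ) (p-prime : Prime p) →
    MinionHom (𝒱 p {{prime⇒nonTrivial p-prime}} p p-prime) (𝒵 (p ^ 2))
proposition4p6 p p-prime = record
  { ξ = λ D → record
    { to = λ (N , S) → record { f = weight S ; sum≈1 = weight-sum S }
    -- Equality of elements compares `𝐢` and `𝐯` modulo `p`; `powerSum-cong` lifts both comparisons
    -- to `p ^ 2`.
    ; cong = λ { (equal _ 𝐢≋ 𝐯≋) a → ℤ/p².*-cong
        (ℤ/p².+-congˡ {+ 2} (ℤ/p².-‿cong (powerSum-cong p-prime 𝐢≋)))
        (powerSum-cong p-prime (𝐯≋ a)) }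
    }
  ; natural = λ {D} {E} α (N , S) → weight-natural {D = D} {E} α S
  }
  where
  open Weight p p-prime
  module ℤ/p² = CommutativeRing (ℤ/ (p ^ 2))
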